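{- Let $a\in\mathbb{N}$ and $b\neq d\in\mathbb{Z}$ with $a\mid\mathrm{lcm}(b,d)$. Then $\omega(G_{a,b,a,d})=\infty$, i.e. $G_{a,b,a,d}$ contains cliques of every finite size.
   Context: $\mathbb{N}=\{1,2,\dots\}$; convention $\mathrm{lcm}(b,0)=0$. For $a,c\in\mathbb{N}$, $b,d\in\mathbb{Z}$, $R_{a,b,c,d} := \left\{ \frac{an+b}{cn+d} : n \in \mathbb{N} \right\} \cap (\mathbb{Q}_{>0}\setminus\{1\})$; $G_{a,b,c,d}$ is the graph with vertex set $\mathbb{N}$ and edge set $\{\{m,n\}: m/n\in R_{a,b,c,d}\}$. $\omega$ denotes clique number. -}

module Defs where

open import Data.Fin.Base using (Fin)
open import Data.Integer.Base as ℤ using (ℤ; +_)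
import Data.Integer.Properties as ℤ
open import Data.Nat.Base as ℕ using (ℕ; suc)
open import Data.Nat.Coprimality as Coprime using (1-coprimeTo)
open import Data.Product.Base using (Σ-syntax; ∃-syntax; _×_; _,_)
open import Data.Rational.Base as ℚ using (ℚ; mkℚ; 0ℚ; 1ℚ; _/_; _÷_)
open import Data.Rational.Properties using (fromℚᵘ-cong)
open import Data.Rational.Unnormalised.Base using (mkℚᵘ; 1ℚᵘ; *≡*)
open import Data.Sum.Base using (inj₁; inj₂; _⊎_; swap)
open import Function.Definitions using (Injective)
open import Level using (0ℓ)
open import Relation.Binary.Core using (Rel)
open import Relation.Binary.Definitions using (Symmetric)
open import Relation.Binary.PropositionalEquality
  using (_≡_; _≢_)
open import Relation.Nullary using (¬_)
open import Relation.Unary using (Pred; _∩_; _∈_)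

-- The proof of non-zeroness is irrelevant, so two elements with the same
-- value are equal.
record ℕ⁺ : Set where
  constructor mkℕ⁺
  field
    value : ℕ
    .{{nonZero}} : ℕ.NonZero value

open ℕ⁺ public

toℤ : ℕ⁺ → ℤ
toℤ n = + value n

fromℤ : ℤ → ℚ
fromℤ i = mkℚ i 0 (Coprime.sym (1-coprimeTo ℤ.∣ i ∣))

_/⁺_ : ℕ⁺ → ℕ⁺ → ℚ
mkℕ⁺ m /⁺ mkℕ⁺ n = + m / n

record SimpleGraph (V : Set) : Set₁ where
  field
    Adj         : Rel V 0ℓ
    symmetric   : Symmetric Adj
    irreflexive : ∀ v → ¬ Adj v v

record Clique {V : Set} (Γ : SimpleGraph V) (k : ℕ) : Set where
  open SimpleGraph Γ
  field
    vertex    : Fin k → V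
    injective : Injective _≡_ _≡_ vertex
    adjacent  : ∀ {i j} → i ≢ j → Adj (vertex i) (vertex j)

-- The clique number is the supremum of the sizes of finite cliques. Any
-- subset of a clique is a clique, so the supremum is infinite exactly when
-- every finite size occurs.
ω_≡∞ : {V : Set} → SimpleGraph V → Set
ω Γ ≡∞ = ∀ k → Clique Γ k

-- Indices n at which the denominator cn + d vanishes contribute no fraction.
Fractions : (a : ℕ⁺) (b : ℤ) (c : ℕ⁺) (d : ℤ) → Pred ℚ 0ℓ
Fractions a b c d q =
  ∃[ n ] Σ[ nz ∈ ℚ.NonZero (den n) ] q ≡ _÷_ (num n) (den n) {{nz}}
  where
  num den : ℕ⁺ → ℚ
  num n = fromℤ (toℤ a ℤ.* toℤ n ℤ.+ b)
  den n = fromℤ (toℤ c ℤ.* toℤ n ℤ.+ d)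

ℚ>0∖1 : Pred ℚ 0ℓ
ℚ>0∖1 q = 0ℚ ℚ.< q × q ≢ 1ℚ

R : (a : ℕ⁺) (b : ℤ) (c : ℕ⁺) (d : ℤ) → Pred ℚ 0ℓ
R a b c d = Fractions a b c d ∩ ℚ>0∖1

n/⁺n≡1 : ∀ n → n /⁺ n ≡ 1ℚ
n/⁺n≡1 (mkℕ⁺ (suc n)) = fromℚᵘ-cong {mkℚᵘ (+ suc n) n} {1ℚᵘ}
  (*≡* (ℤ.*-comm (+ suc n) (+ 1)))

-- An edge is an unordered pair {m, n}, so either of the two ratios m/n and
-- n/m may be the one lying in R.
G : (a : ℕ⁺) (b : ℤ) (c : ℕ⁺) (d : ℤ) → SimpleGraph ℕ⁺
G a b c d = record
  { Adj         = λ m n → m /⁺ n ∈ R a b c d ⊎ n /⁺ m ∈ R a b c d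
  ; symmetric   = swap
  ; irreflexive = λ n → λ
      { (inj₁ (_ , _ , n/n≢1)) → n/n≢1 (n/⁺n≡1 n)
      ; (inj₂ (_ , _ , n/n≢1)) → n/n≢1 (n/⁺n≡1 n)
      }
  }

{-# OPTIONS --safe #-}

-- Let lo < hi be b and d in order, and D = hi - lo. Choose coprime α ∣ lo
-- and β ∣ hi with a ∣ α β. If m < n, δ = n - m, m = q δ and n = (q + 1) δ, where
-- α ∣ q and β ∣ q + 1, then D q ≡ lo modulo α and modulo β, so
-- D q = a t + lo and D (q + 1) = a t + hi for some t, and {m, n} is an edge.
-- It thus suffices to find arbitrarily long sequences m₁ < m₂ < ... such that
-- α (mⱼ - mᵢ) ∣ mᵢ and β (mⱼ - mᵢ) ∣ mⱼ whenever i < j. Such a sequence is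
-- extended at the bottom, to N - B, N + β m₁, N + β m₂, ..., where B is
-- coprime to β but absorbs all other primes of the mᵢ, and N is divisible
-- by a large modulus and congruent to B modulo every α (β mᵢ + B).

module Submission where

open import Defs
open import Data.Fin.Base as Fin using (Fin; zero; suc)
import Data.Fin.Properties as Fin
open import Data.Integer.Base as ℤ using (ℤ; ∣_∣)
open import Data.Integer.Divisibility using (_∣_)
import Data.Integer.Divisibility.Signed as Signed
open import Data.Integer.LCM using (lcm)
import Data.Integer.Properties as ℤ
import Data.Integer.Tactic.RingSolver as ℤ-Solver
open import Data.Nat.Base as ℕ using (ℕ; NonZero; _+_; _*_; _<_; s≤s)
open import Data.Nat.Coprimality as Coprime using (Coprime; coprime-divisor)
import Data.Nat.Divisibility as ∣
open import Data.Nat.GCD using (gcd; gcd[m,n]∣m; gcd[m,n]∣n; module Bézout)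
open import Data.Nat.Induction using (<-rec)
import Data.Nat.LCM as ℕ
import Data.Nat.Properties as ℕ
import Data.Nat.Tactic.RingSolver as ℕ-Solver
open import Data.Product.Base using (∃-syntax; _×_; _,_; proj₁; proj₂)
import Data.Rational.Base as ℚ
import Data.Rational.Properties as ℚ
open import Data.Rational.Unnormalised.Base as ℚᵘ using (mkℚᵘ; *≡*)
import Data.Rational.Unnormalised.Properties as ℚᵘ
open import Data.Sum.Base using (inj₁; inj₂)
open import Function.Base using (_∘_)
open import Relation.Binary.Definitions using (tri<; tri≈; tri>)
open import Relation.Binary.PropositionalEquality
  using (_≡_; _≢_; refl; sym; trans; cong; subst; subst₂; module ≡-Reasoning)
open import Relation.Nullary using (contradiction; yes; no)

open ∣ using () renaming (_∣_ to _∣ₙ_)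

-- Coprimality, and the part of a number coprime to `β`

coprime-∣ˡ : ∀ {d m n} → d ∣ₙ m → Coprime m n → Coprime d n
coprime-∣ˡ d∣m c (e∣d , e∣n) = c (∣.∣-trans e∣d d∣m , e∣n)

coprime-*ˡ : ∀ {m n o} → Coprime m o → Coprime n o → Coprime (m * n) o
coprime-*ˡ {m} {n} {o} cm cn {d} (d∣mn , d∣o) =
  cn (coprime-divisor (coprime-∣ˡ d∣o (Coprime.sym cm)) d∣mn , d∣o)

coprime-*ʳ : ∀ {m n o} → Coprime o m → Coprime o n → Coprime o (m * n)
coprime-*ʳ cm cn = Coprime.sym (coprime-*ˡ (Coprime.sym cm) (Coprime.sym cn))

coprime-+ˡ : ∀ {m n o} → o ∣ₙ m → Coprime n o → Coprime (m + n) o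
coprime-+ˡ o∣m c (d∣m+n , d∣o) = c (∣.∣m+n∣m⇒∣n d∣m+n (∣.∣-trans d∣o o∣m) , d∣o)

coprime-+ʳ : ∀ {m n o} → o ∣ₙ n → Coprime m o → Coprime (m + n) o
coprime-+ʳ {m} {n} {o} o∣n c = subst (λ x → Coprime x o) (ℕ.+-comm n m) (coprime-+ˡ o∣n c)

coprime-*-∣ : ∀ {m n o} → Coprime m n → m ∣ₙ o → n ∣ₙ o → m * n ∣ₙ o
coprime-*-∣ {m} {n} c m∣o (∣.divides q refl) =
  ∣.*-monoˡ-∣ n (coprime-divisor c (subst (m ∣ₙ_) (ℕ.*-comm q n) m∣o))

nonZero-factors : ∀ {x} m n → x ≡ m * n → .{{NonZero x}} → NonZero m × NonZero n
nonZero-factors m n refl = ℕ.m*n≢0⇒m≢0 m , ℕ.m*n≢0⇒n≢0 m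

-- Supportedness expresses, without mentioning primes, that every prime factor
-- of rest divides β.
record CoprimePart (β x : ℕ) : Set where
  field
    part rest      : ℕ
    factors        : x ≡ part * rest
    part-coprime   : Coprime part β
    rest-supported : ∀ {z} → Coprime z β → Coprime z rest

  part∣ : part ∣ₙ x
  part∣ = subst (part ∣ₙ_) (sym factors) (∣.m∣m*n rest)

-- Strong induction on `x`: as long as `x` shares a factor with `β`, the gcd is divided out and
-- moved into `rest`. That gcd divides `β`, so whatever is coprime to `β` is coprime to it.
coprimePart : ∀ β x .{{_ : NonZero x}} → CoprimePart β x
coprimePart β x {{x≢0}} = <-rec (λ x → .(NonZero x) → CoprimePart β x) step x x≢0
  where
  step : ∀ x → (∀ {y} → y < x → .(NonZero y) → CoprimePart β y) →
         .(NonZero x) → CoprimePart β x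
  step x rec x≢0 with Coprime.coprime? x β
  ... | yes c = record
    { part = x; rest = 1; factors = sym (ℕ.*-identityʳ x); part-coprime = c
    ; rest-supported = λ _ → Coprime.sym (Coprime.1-coprimeTo _) }
  ... | no ¬c with gcd[m,n]∣m x β
  ... | ∣.divides y x≡y*h = record
    { part = part; rest = h * rest
    ; factors = trans x≡y*h (trans (cong (_* h) factors) (rearrange part rest h))
    ; part-coprime = part-coprime
    ; rest-supported = λ c → coprime-*ʳ
        (Coprime.sym (coprime-∣ˡ (gcd[m,n]∣n x β) (Coprime.sym c)))
        (rest-supported c) }
    where
    h : ℕ
    h = gcd x β
    instance
      _ : NonZero x
      _ = ℕ.≢-nonZero (ℕ.≢-nonZero⁻¹ x {{x≢0}})
      y≢0 : NonZero y
      y≢0 = proj₁ (nonZero-factors y h x≡y*h)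
      h≢0 : NonZero h
      h≢0 = proj₂ (nonZero-factors y h x≡y*h)
    1<h : 1 < h
    1<h = ℕ.≤∧≢⇒< (ℕ.>-nonZero⁻¹ h) (¬c ∘ Coprime.gcd≡1⇒coprime ∘ sym)
    open CoprimePart (rec (subst (y <_) (sym x≡y*h) (ℕ.m<m*n y h 1<h)) y≢0)
    rearrange : ∀ p r h → p * r * h ≡ p * (h * r)
    rearrange = ℕ-Solver.solve-∀

-- Splitting a divisor of the lcm into coprime factors

record CoprimeSplitting (a x y : ℕ) : Set where
  field
    α β      : ℕ
    {{α≢0}}  : NonZero α
    {{β≢0}}  : NonZero β
    coprime  : Coprime α β
    α∣x      : α ∣ₙ x
    β∣y      : β ∣ₙ y
    a∣αβ     : a ∣ₙ α * β

-- If an argument is 0, it is divisible by all of `a`, and the other factor is 1. Otherwise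
-- `x = x′ * g` and `y = y′ * g` with `x′`, `y′` coprime. The primes of `g` dividing `y′` go to `β`
-- and the others to `α`, so that `α * β = x′ * y′ * g` is the lcm.
coprimeSplitting : ∀ a x y .{{_ : NonZero a}} → a ∣ₙ ℕ.lcm x y → CoprimeSplitting a x y
coprimeSplitting a@(ℕ.suc _) ℕ.zero y _ = record
  { α = a; β = 1; coprime = Coprime.sym (Coprime.1-coprimeTo a)
  ; α∣x = a ∣.∣0; β∣y = ∣.1∣ y; a∣αβ = ∣.m∣m*n 1 }
coprimeSplitting a@(ℕ.suc _) (ℕ.suc _) ℕ.zero _ = record
  { α = 1; β = a; coprime = Coprime.1-coprimeTo a
  ; α∣x = ∣.1∣ _; β∣y = a ∣.∣0; a∣αβ = ∣.n∣m*n 1 }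
coprimeSplitting a x@(ℕ.suc _) y@(ℕ.suc _) a∣lcm
  with gcd[m,n]∣m x y | gcd[m,n]∣n x y
... | ∣.divides x′ x≡ | ∣.divides y′ y≡ = record
  { α = x′ * part
  ; β = y′ * rest
  ; α≢0 = ℕ.m*n≢0 x′ part
  ; β≢0 = ℕ.m*n≢0 y′ rest
  ; coprime = coprime-*ˡ (coprime-*ʳ x′⊥y′ (rest-supported x′⊥y′))
                         (coprime-*ʳ part-coprime (rest-supported part-coprime))
  ; α∣x = α∣
  ; β∣y = β∣
  ; a∣αβ = ∣.∣-trans a∣lcm (ℕ.lcm-least x∣αβ y∣αβ)
  }
  where
  g : ℕ
  g = gcd x y
  instance
    g≢0 : NonZero g
    g≢0 = proj₂ (nonZero-factors x′ g x≡)
    x′≢0 : NonZero x′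
    x′≢0 = proj₁ (nonZero-factors x′ g x≡)
    y′≢0 : NonZero y′
    y′≢0 = proj₁ (nonZero-factors y′ g y≡)
  open CoprimePart (coprimePart y′ g)
  instance
    part≢0 : NonZero part
    part≢0 = proj₁ (nonZero-factors part rest factors)
    rest≢0 : NonZero rest
    rest≢0 = proj₂ (nonZero-factors part rest factors)
  x′⊥y′ : Coprime x′ y′
  x′⊥y′ = subst₂ Coprime
    (∣.n/m≡quotient (∣.divides x′ x≡)) (∣.n/m≡quotient (∣.divides y′ y≡))
    (Coprime.coprime-/gcd x y)
  α∣ : x′ * part ∣ₙ x
  α∣ = subst (x′ * part ∣ₙ_) (sym x≡) (∣.*-monoʳ-∣ x′ part∣)
  β∣ : y′ * rest ∣ₙ y
  β∣ = subst (y′ * rest ∣ₙ_) (sym y≡) (∣.*-monoʳ-∣ y′ (∣.divides part factors))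
  x∣αβ : x ∣ₙ x′ * part * (y′ * rest)
  x∣αβ = ∣.divides y′ (trans (eq₁ x′ part y′ rest)
    (cong (y′ *_) (trans (cong (x′ *_) (sym factors)) (sym x≡))))
    where
    eq₁ : ∀ x p y r → x * p * (y * r) ≡ y * (x * (p * r))
    eq₁ = ℕ-Solver.solve-∀
  y∣αβ : y ∣ₙ x′ * part * (y′ * rest)
  y∣αβ = ∣.divides x′ (trans (eq₁ x′ part y′ rest)
    (cong (x′ *_) (trans (cong (y′ *_) (sym factors)) (sym y≡))))
    where
    eq₁ : ∀ x p y r → x * p * (y * r) ≡ x * (y * (p * r))
    eq₁ = ℕ-Solver.solve-∀

-- Chains, products and negated inverses

record Linked (α β m n : ℕ) : Set where
  field
    δ       : ℕ
    {{δ≢0}} : NonZero δ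
    n≡m+δ   : n ≡ m + δ
    αδ∣m    : α * δ ∣ₙ m
    βδ∣n    : β * δ ∣ₙ n

record Chain (α β k : ℕ) : Set where
  field
    term   : Fin k → ℕ
    term≢0 : ∀ i → NonZero (term i)
    linked : ∀ {i j} → i Fin.< j → Linked α β (term i) (term j)

∏ : ∀ {k} → (Fin k → ℕ) → ℕ
∏ {ℕ.zero}  f = 1
∏ {ℕ.suc _} f = f zero * ∏ (f ∘ suc)

∣∏ : ∀ {k} (f : Fin k → ℕ) i → f i ∣ₙ ∏ f
∣∏ f zero    = ∣.m∣m*n _
∣∏ f (suc i) = ∣.∣n⇒∣m*n (f zero) (∣∏ (f ∘ suc) i)

∏≢0 : ∀ {k} (f : Fin k → ℕ) → (∀ i → NonZero (f i)) → NonZero (∏ f)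
∏≢0 {ℕ.zero}  f _  = _
∏≢0 {ℕ.suc _} f f≢0 =
  ℕ.m*n≢0 (f zero) (∏ (f ∘ suc)) {{f≢0 zero}} {{∏≢0 (f ∘ suc) (f≢0 ∘ suc)}}

∏-coprime : ∀ {k n} (f : Fin k → ℕ) → (∀ i → Coprime (f i) n) → Coprime (∏ f) n
∏-coprime {ℕ.zero}  f _ = Coprime.1-coprimeTo _
∏-coprime {ℕ.suc _} f c = coprime-*ˡ (c zero) (∏-coprime (f ∘ suc) (c ∘ suc))

-- Bézout gives either `1 + x * u = z * w`, where `x` already serves, or `1 + z * w = x * u`, where
-- `x` is an inverse of `u` and is multiplied by `w-1`, which is -1 modulo `w`. Adding `w` makes the
-- result positive.
negInverse : ∀ {u w} .{{_ : NonZero w}} → Coprime u w →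
             ∃[ y ] NonZero y × w ∣ₙ 1 + u * y
negInverse {u} {w@(ℕ.suc w-1)} c with Coprime.coprime-Bézout c
... | Bézout.-+ x z eq = x + w , ℕ.≢-nonZero (ℕ.m+1+n≢0 x) ,
  ∣.divides (z + u) (begin
    1 + u * (x + w)       ≡⟨ eq₁ u x w ⟩
    (1 + x * u) + u * w   ≡⟨ cong (_+ u * w) eq ⟩
    z * w + u * w         ≡⟨ ℕ.*-distribʳ-+ w z u ⟨
    (z + u) * w           ∎)
  where
  open ≡-Reasoning
  eq₁ : ∀ u x w → 1 + u * (x + w) ≡ (1 + x * u) + u * w
  eq₁ = ℕ-Solver.solve-∀
... | Bézout.+- x z eq = x * w-1 + w , ℕ.≢-nonZero (ℕ.m+1+n≢0 (x * w-1)) ,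
  ∣.divides (1 + z * w-1 + u) (begin
    1 + u * (x * w-1 + w)            ≡⟨ eq₁ u x w-1 w ⟩
    1 + x * u * w-1 + u * w          ≡⟨ cong (λ e → 1 + e * w-1 + u * w) eq ⟨
    1 + (1 + z * w) * w-1 + u * w    ≡⟨ eq₂ u z w-1 ⟩
    (1 + z * w-1 + u) * w            ∎)
  where
  open ≡-Reasoning
  eq₁ : ∀ u x w-1 w → 1 + u * (x * w-1 + w) ≡ 1 + x * u * w-1 + u * w
  eq₁ = ℕ-Solver.solve-∀
  eq₂ : ∀ u z w → 1 + (1 + z * (1 + w)) * w + u * (1 + w) ≡ (1 + z * w + u) * (1 + w)
  eq₂ = ℕ-Solver.solve-∀

-- Extending a chain at the bottom

module _ {α β : ℕ} {{α≢0 : NonZero α}} {{β≢0 : NonZero β}} (α⊥β : Coprime α β) where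

  module Extend {k} (chain : Chain α β k) where
    open Chain chain

    X : ℕ
    X = ∏ term

    instance
      X≢0 : NonZero X
      X≢0 = ∏≢0 term term≢0

    open CoprimePart (coprimePart β X)
      renaming (part to C; rest to C₂; factors to X≡CC₂; part-coprime to C⊥β;
                rest-supported to C₂-supported)

    module _ (i : Fin k) where
      instance
        mᵢ≢0 : NonZero (term i)
        mᵢ≢0 = term≢0 i

      open CoprimePart (coprimePart β (term i)) public
        using ()
        renaming (part to c; rest to n; factors to m≡cn; part-coprime to c⊥β;
                  rest-supported to n-supported; part∣ to c∣m)

      -- `c` divides `X = C * C₂` and, being coprime to `β`, is coprime to `C₂`.
      c∣C : c ∣ₙ C
      c∣C = coprime-divisor (C₂-supported c⊥β)
        (subst (c ∣ₙ_) (trans X≡CC₂ (ℕ.*-comm C C₂)) (∣.∣-trans c∣m (∣∏ term i)))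

      e : ℕ
      e = ∣.quotient c∣C

      C≡ec : C ≡ e * c
      C≡ec = ∣._∣_.equality c∣C

      -- What remains of `β * term i + α * C * C` once `c` is taken out, using `C = e * c`.
      v : ℕ
      v = β * n + α * C * e

      -- Modulo `β` only `α * C * e` remains, and each of its factors is coprime to `β`.
      v⊥β : Coprime v β
      v⊥β = coprime-+ˡ (∣.m∣m*n n)
        (coprime-*ˡ (coprime-*ˡ α⊥β C⊥β) (coprime-∣ˡ (∣.quotient-∣ c∣C) C⊥β))

      -- Modulo `C` only `β * n` remains, and all primes of `n` divide `β`. The second factor `C` of
      -- `B` is what keeps a `C` in the other summand after division by `c`.
      v⊥C : Coprime v C
      v⊥C = coprime-+ʳ (∣.n∣m*n*o α e)
        (coprime-*ˡ (Coprime.sym C⊥β) (Coprime.sym (n-supported C⊥β)))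

      v⊥X : Coprime v X
      v⊥X = subst (Coprime v) (sym X≡CC₂) (coprime-*ʳ v⊥C (C₂-supported v⊥β))

      v⊥W : Coprime v (β * β * X)
      v⊥W = coprime-*ʳ (coprime-*ʳ v⊥β v⊥β) v⊥X

      cv≢0 : NonZero (c * v)
      cv≢0 = ℕ.m*n≢0 c v {{proj₁ c,n≢0}}
        {{ℕ.≢-nonZero (ℕ.≢-nonZero⁻¹ (β * n) {{ℕ.m*n≢0 β n {{β≢0}} {{proj₂ c,n≢0}}}}
          ∘ ℕ.m+n≡0⇒m≡0 (β * n))}}
        where
        c,n≢0 : NonZero c × NonZero n
        c,n≢0 = nonZero-factors c n m≡cn

      β⊥cv : Coprime β (c * v)
      β⊥cv = coprime-*ʳ (Coprime.sym c⊥β) (Coprime.sym v⊥β)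

    u W B : ℕ
    u = ∏ v
    W = β * β * X
    B = α * C * C

    instance
      C≢0 : NonZero C
      C≢0 = proj₁ (nonZero-factors C C₂ X≡CC₂)
      W≢0 : NonZero W
      W≢0 = ℕ.m*n≢0 (β * β) X {{ℕ.m*n≢0 β β}}
      B≢0 : NonZero B
      B≢0 = ℕ.m*n≢0 (α * C) C {{ℕ.m*n≢0 α C}}

    inverse : ∃[ y ] NonZero y × W ∣ₙ 1 + u * y
    inverse = negInverse (∏-coprime v v⊥W)

    y N x₀ : ℕ
    y  = proj₁ inverse
    -- `N` is 0 modulo `W` by the choice of `y`, while `N - B = x₀` is a multiple of `B * u`.
    N  = B * (1 + u * y)
    x₀ = B * (u * y)

    W∣N : W ∣ₙ N
    W∣N = ∣.∣n⇒∣m*n B (proj₂ (proj₂ inverse))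

    x₀≢0 : NonZero x₀
    x₀≢0 = ℕ.m*n≢0 B (u * y) {{B≢0}} {{ℕ.m*n≢0 u y
      {{∏≢0 v (λ i → proj₂ (nonZero-factors (c i) (v i) refl {{cv≢0 i}}))}}
      {{proj₁ (proj₂ inverse)}}}}

    -- Here c i * v i = β * term i + B. Only the factor v i has to be inverted
    -- to make N - B divisible by α * (c i * v i), since α * c i ∣ B.
    x : Fin (ℕ.suc k) → ℕ
    x zero    = x₀
    x (suc i) = N + β * term i

    x-suc : ∀ i → x (suc i) ≡ x₀ + c i * v i
    x-suc i = begin
      N + β * term i                                   ≡⟨ cong (λ m → N + β * m) (m≡cn i) ⟩
      α * C * C * (1 + u * y) + β * (c i * n i)        ≡⟨ eq₁ (α * C) C (u * y) _ ⟩
      x₀ + (β * (c i * n i) + α * C * C)               ≡⟨ cong (λ z → x₀ + (β * (c i * n i) + α * C * z)) (C≡ec i) ⟩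
      x₀ + (β * (c i * n i) + α * C * (e i * c i))     ≡⟨ cong (x₀ +_) (eq₂ β (c i) (n i) (α * C) (e i)) ⟩
      x₀ + c i * v i                                   ∎
      where
      open ≡-Reasoning
      eq₁ : ∀ p q r s → p * q * (1 + r) + s ≡ p * q * r + (s + p * q)
      eq₁ = ℕ-Solver.solve-∀
      eq₂ : ∀ b c n p e → b * (c * n) + p * (e * c) ≡ c * (b * n + p * e)
      eq₂ = ℕ-Solver.solve-∀

    x≢0 : ∀ i → NonZero (x i)
    x≢0 zero    = x₀≢0
    x≢0 (suc i) = subst NonZero (sym (x-suc i))
      (ℕ.≢-nonZero (ℕ.≢-nonZero⁻¹ x₀ {{x₀≢0}} ∘ ℕ.m+n≡0⇒m≡0 x₀))

    ∣term⇒β∣W : ∀ {d} i → d ∣ₙ term i → β * (β * d) ∣ₙ W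
    ∣term⇒β∣W {d} i d∣m = subst (_∣ₙ W) (ℕ.*-assoc β β d)
      (∣.*-monoʳ-∣ (β * β) (∣.∣-trans d∣m (∣∏ term i)))

    -- Both summands of `x (suc i)` are multiples of `β * d`: `N` because `W` is, and `β * term i`
    -- directly.
    ∣term⇒∣x : ∀ {d} i → d ∣ₙ term i → β * d ∣ₙ x (suc i)
    ∣term⇒∣x i d∣m = ∣.∣m∣n⇒∣m+n
      (∣.∣-trans (∣.∣-trans (∣.n∣m*n β) (∣term⇒β∣W i d∣m)) W∣N)
      (∣.*-monoʳ-∣ β d∣m)

    x-linked : ∀ {i j} → i Fin.< j → Linked α β (x i) (x j)
    x-linked {zero} {suc j} _ = record
      { δ     = c j * v j
      ; δ≢0   = cv≢0 j
      ; n≡m+δ = x-suc j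
      ; αδ∣m  = αδ∣x₀
      -- The coprime factors `β` and `c j * v j` are handled separately; the latter divides both
      -- `x₀` and the difference.
      ; βδ∣n  = coprime-*-∣ (β⊥cv j)
          (subst (_∣ₙ x (suc j)) (ℕ.*-identityʳ β) (∣term⇒∣x j (∣.1∣ term j)))
          (subst (c j * v j ∣ₙ_) (sym (x-suc j))
            (∣.∣m∣n⇒∣m+n (∣.∣-trans (∣.n∣m*n α) αδ∣x₀) ∣.∣-refl))
      }
      where
      αδ∣x₀ : α * (c j * v j) ∣ₙ x₀
      αδ∣x₀ = subst (_∣ₙ x₀) (ℕ.*-assoc α (c j) (v j)) (∣.*-pres-∣
        (∣.∣m⇒∣m*n C (∣.*-monoʳ-∣ α (c∣C j)))
        (∣.∣m⇒∣m*n y (∣∏ v j)))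
    x-linked {suc i} {suc j} (s≤s i<j) = record
      -- The shift by `N` cancels in differences, and the scaling multiplies them by `β`. The terms
      -- gain the same factor in their divisors by `∣term⇒∣x`.
      { δ     = β * δ
      ; δ≢0   = ℕ.m*n≢0 β δ {{β≢0}} {{δ≢0}}
      ; n≡m+δ = begin
          N + β * term j             ≡⟨ cong (λ m → N + β * m) n≡m+δ ⟩
          N + β * (term i + δ)       ≡⟨ cong (N +_) (ℕ.*-distribˡ-+ β (term i) δ) ⟩
          N + (β * term i + β * δ)   ≡⟨ ℕ.+-assoc N _ _ ⟨
          N + β * term i + β * δ     ∎
      ; αδ∣m  = subst (_∣ₙ x (suc i)) (swap-* β α δ) (∣term⇒∣x i αδ∣m)
      ; βδ∣n  = ∣term⇒∣x j βδ∣n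
      }
      where
      open Linked (linked i<j)
      open ≡-Reasoning
      swap-* : ∀ p q r → p * (q * r) ≡ q * (p * r)
      swap-* = ℕ-Solver.solve-∀

    extended : Chain α β (ℕ.suc k)
    extended = record { term = x; term≢0 = x≢0; linked = x-linked }

  chain : ∀ k → Chain α β k
  chain ℕ.zero    = record { term = λ (); term≢0 = λ (); linked = λ { {()} } }
  chain (ℕ.suc k) = Extend.extended (chain k)

linked⇒< : ∀ {α β m n} → Linked α β m n → m < n
linked⇒< {m = m} l = subst (m <_) (sym n≡m+δ) (ℕ.m<m+n m (ℕ.>-nonZero⁻¹ δ {{δ≢0}}))
  where open Linked l

chain-injective : ∀ {α β k} (C : Chain α β k) {i j} →
                  Chain.term C i ≡ Chain.term C j → i ≡ j
chain-injective C {i} {j} eq with Fin.<-cmp i j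
... | tri< i<j _ _ = contradiction eq (ℕ.<⇒≢ (linked⇒< (Chain.linked C i<j)))
... | tri≈ _ i≡j _ = i≡j
... | tri> _ _ j<i = contradiction (sym eq) (ℕ.<⇒≢ (linked⇒< (Chain.linked C j<i)))

-- Fractions as rational numbers

-- Comparing unnormalised rationals reduces the claim to cross-multiplication. Numerator and
-- denominator enter through equations, so that matching on `refl` replaces the integer expressions
-- by naturals.
fraction≡÷ : ∀ (m n : ℕ⁺) (x y : ℕ) .{{_ : NonZero y}} →
             value m * y ≡ x * value n → ∀ {i j} → i ≡ ℤ.+ x → j ≡ ℤ.+ y →
             ∃[ nz ] m /⁺ n ≡ ℚ._÷_ (fromℤ i) (fromℤ j) {{nz}}
fraction≡÷ (mkℕ⁺ m) (mkℕ⁺ n@(ℕ.suc n-1)) x y@(ℕ.suc y-1) my≡xn refl refl =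
  _ , ℚ.toℚᵘ-injective (begin
    ℚ.toℚᵘ (ℤ.+ m ℚ./ n)                            ≈⟨ ℚ.toℚᵘ-fromℚᵘ (mkℚᵘ (ℤ.+ m) n-1) ⟩
    mkℚᵘ (ℤ.+ m) n-1                                ≈⟨ *≡* eq ⟩
    mkℚᵘ (ℤ.+ x) 0 ℚᵘ.* mkℚᵘ (ℤ.+ 1) y-1            ≈⟨ ℚ.toℚᵘ-homo-* (fromℤ (ℤ.+ x)) (ℚ.1/ (fromℤ (ℤ.+ y))) ⟨
    ℚ.toℚᵘ (fromℤ (ℤ.+ x) ℚ.÷ fromℤ (ℤ.+ y))        ∎)
  where
  open ℚᵘ.≃-Reasoning
  eq : ℤ.+ m ℤ.* (ℤ.+ (1 * y)) ≡ (ℤ.+ x ℤ.* ℤ.+ 1) ℤ.* ℤ.+ n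
  eq = trans (sym (ℤ.pos-* m (1 * y))) (trans
    (cong ℤ.+_ (trans (cong (m *_) (ℕ.*-identityˡ y)) my≡xn))
    (trans (ℤ.pos-* x n) (cong (ℤ._* ℤ.+ n) (sym (ℤ.*-identityʳ (ℤ.+ x))))))

fraction-∈ℚ>0∖1 : ∀ m n → value m ≢ value n → ℚ>0∖1 (m /⁺ n)
fraction-∈ℚ>0∖1 (mkℕ⁺ m@(ℕ.suc _)) (mkℕ⁺ n@(ℕ.suc n-1)) m≢n =
  ℚ.positive⁻¹ _ {{ℚ.normalize-pos m n}} , λ m/n≡1 →
    m≢n (ℤ.+-injective (m≡n (ℚ./-injective-≃ (mkℚᵘ (ℤ.+ m) n-1) (mkℚᵘ (ℤ.+ 1) 0) m/n≡1)))
  where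
  m≡n : mkℚᵘ (ℤ.+ m) n-1 ℚᵘ.≃ mkℚᵘ (ℤ.+ 1) 0 → ℤ.+ m ≡ ℤ.+ n
  m≡n (*≡* eq) = trans (sym (ℤ.*-identityʳ (ℤ.+ m))) (trans eq (ℤ.*-identityˡ (ℤ.+ n)))

-- Realising the ratio of linked numbers

i≤∣i∣ : ∀ i → i ℤ.≤ ℤ.+ ∣ i ∣
i≤∣i∣ (ℤ.+ n)    = ℤ.≤-refl
i≤∣i∣ ℤ.-[1+ n ] = ℤ.-≤+

i-j+j≡i : ∀ i j → i ℤ.- j ℤ.+ j ≡ i
i-j+j≡i = ℤ-Solver.solve-∀

∣m∣n⇒∣m-n : ∀ {d} i j → d ∣ₙ ∣ i ∣ → d ∣ₙ ∣ j ∣ → d ∣ₙ ∣ i ℤ.- j ∣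
∣m∣n⇒∣m-n {d} i j d∣i d∣j = Signed.∣⇒∣ᵤ {ℤ.+ d} {i ℤ.- j}
  (Signed.∣m∣n⇒∣m-n (Signed.∣ᵤ⇒∣ {ℤ.+ d} {i} d∣i) (Signed.∣ᵤ⇒∣ {ℤ.+ d} {j} d∣j))

-- `t` is the index of the fraction, and `p / q` is the ratio `n / m`. The order of numerator and
-- denominator is left open, so that both signs of `b - d` are covered.
record Realised (a : ℕ) (lo hi : ℤ) (m n : ℕ) : Set where
  field
    t p q    : ℕ
    {{t≢0}}  : NonZero t
    {{p≢0}}  : NonZero p
    {{q≢0}}  : NonZero q
    at+lo≡q  : ℤ.+ a ℤ.* ℤ.+ t ℤ.+ lo ≡ ℤ.+ q
    at+hi≡p  : ℤ.+ a ℤ.* ℤ.+ t ℤ.+ hi ≡ ℤ.+ p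
    nq≡pm    : n * q ≡ p * m

module Realise {a : ℕ} .{{a≢0 : NonZero a}} {lo hi : ℤ} (lo<hi : lo ℤ.< hi)
               (s : CoprimeSplitting a ∣ lo ∣ ∣ hi ∣) where
  open CoprimeSplitting s

  -- A multiple of α, still coprime to β, that forces the indices of the
  -- fractions to be positive.
  α′ : ℕ
  α′ = α * (1 + β * ∣ lo ∣)

  α′⊥β : Coprime α′ β
  α′⊥β = coprime-*ˡ coprime (coprime-+ʳ (∣.m∣m*n ∣ lo ∣) (Coprime.1-coprimeTo β))

  instance
    α′≢0 : NonZero α′
    α′≢0 = ℕ.m*n≢0 α (1 + β * ∣ lo ∣)

  chain′ : ∀ k → Chain α′ β k
  chain′ = chain α′⊥β

  ∣lo∣<α′ : ∣ lo ∣ < α′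
  ∣lo∣<α′ = ℕ.≤-trans (s≤s (ℕ.m≤n*m ∣ lo ∣ β)) (ℕ.m≤n*m (1 + β * ∣ lo ∣) α)

  D : ℕ
  D = ∣ hi ℤ.- lo ∣

  +D≡hi-lo : ℤ.+ D ≡ hi ℤ.- lo
  +D≡hi-lo = ℤ.0≤i⇒+∣i∣≡i (ℤ.i≤j⇒0≤j-i (ℤ.<⇒≤ lo<hi))

  instance
    D≢0 : NonZero D
    D≢0 = ℕ.≢-nonZero λ D≡0 →
      ℤ.<⇒≢ lo<hi (sym (ℤ.i-j≡0⇒i≡j hi lo (ℤ.∣i∣≡0⇒i≡0 D≡0)))

  realise : ∀ {m n} → .(NonZero m) → Linked α′ β m n → Realised a lo hi m n
  realise {m} {n} m≢0 record { δ = δ ; n≡m+δ = n≡m+δ ; αδ∣m = ∣.divides k m≡ ; βδ∣n = βδ∣n } =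
    record
      { t = t; p = D * (1 + q); q = D * q
      ; t≢0 = t≢0
      ; p≢0 = ℕ.m*n≢0 D (1 + q)
      ; q≢0 = ℕ.m*n≢0 D q
      ; at+lo≡q = at+lo≡q
      ; at+hi≡p = at+hi≡p
      ; nq≡pm = begin
          n * (D * q)                 ≡⟨ cong (_* (D * q)) n≡pδ ⟩
          (1 + q) * δ * (D * q)       ≡⟨ eq₁ D q δ ⟩
          D * (1 + q) * (q * δ)       ≡⟨ cong (D * (1 + q) *_) m≡qδ ⟨
          D * (1 + q) * m             ∎
      }
    where
    open ≡-Reasoning
    q : ℕ
    q = k * α′
    eq₁ : ∀ D q δ → (1 + q) * δ * (D * q) ≡ D * (1 + q) * (q * δ)
    eq₁ = ℕ-Solver.solve-∀

    m≡qδ : m ≡ q * δ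
    m≡qδ = trans m≡ (sym (ℕ.*-assoc k α′ δ))
    n≡pδ : n ≡ (1 + q) * δ
    n≡pδ = trans n≡m+δ (trans (ℕ.+-comm m δ) (cong (δ ℕ.+_) m≡qδ))

    instance
      _ : NonZero m
      _ = ℕ.≢-nonZero (ℕ.≢-nonZero⁻¹ m {{m≢0}})
      q≢0 : NonZero q
      q≢0 = proj₁ (nonZero-factors q δ m≡qδ)
      k≢0 : NonZero k
      k≢0 = proj₁ (nonZero-factors k α′ refl)

    β∣p : β ∣ₙ 1 + q
    β∣p = ∣.*-cancelʳ-∣ δ (subst (β * δ ∣ₙ_) n≡pδ βδ∣n)

    -- `z` is to be `a * t`. It equals both `D * q - lo` and `D * (1 + q) - hi`; the first form
    -- shows divisibility by `α`, the second by `β`.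
    z : ℤ
    z = ℤ.+ (D * q) ℤ.- lo

    Dq+D : ℤ.+ (D * (1 + q)) ≡ ℤ.+ (D * q) ℤ.+ (hi ℤ.- lo)
    Dq+D = trans (cong ℤ.+_ (trans (ℕ.*-suc D q) (ℕ.+-comm D (D * q))))
      (cong (λ i → ℤ.+ (D * q) ℤ.+ i) +D≡hi-lo)

    z≡ : z ≡ ℤ.+ (D * (1 + q)) ℤ.- hi
    z≡ = sym (trans (cong (ℤ._- hi) Dq+D) (eq (ℤ.+ (D * q)) hi lo))
      where
      eq : ∀ x h l → x ℤ.+ (h ℤ.- l) ℤ.- h ≡ x ℤ.- l
      eq = ℤ-Solver.solve-∀

    α∣z : α ∣ₙ ∣ z ∣
    α∣z = ∣m∣n⇒∣m-n (ℤ.+ (D * q)) lo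
      (∣.∣n⇒∣m*n D (∣.∣n⇒∣m*n k (∣.m∣m*n _))) α∣x

    β∣z : β ∣ₙ ∣ z ∣
    β∣z = subst (λ i → β ∣ₙ ∣ i ∣) (sym z≡)
      (∣m∣n⇒∣m-n (ℤ.+ (D * (1 + q))) hi (∣.∣n⇒∣m*n D β∣p) β∣y)

    lo<Dq : lo ℤ.< ℤ.+ (D * q)
    -- The enlarged `α′` is used here: `∣ lo ∣ < α′ ≤ k * α′ = q ≤ D * q`. Hence `z`, and with it
    -- `t`, is positive.
    lo<Dq = ℤ.≤-<-trans (i≤∣i∣ lo) (ℤ.+<+ (ℕ.<-≤-trans ∣lo∣<α′
      (ℕ.≤-trans (ℕ.m≤n*m α′ k) (ℕ.m≤n*m q D))))

    a∣z : a ∣ₙ ∣ z ∣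
    a∣z = ∣.∣-trans a∣αβ (coprime-*-∣ coprime α∣z β∣z)

    t : ℕ
    t = ∣.quotient a∣z

    ∣z∣≢0 : NonZero ∣ z ∣
    ∣z∣≢0 = ℕ.≢-nonZero λ ∣z∣≡0 →
      ℤ.<⇒≢ lo<Dq (sym (ℤ.i-j≡0⇒i≡j (ℤ.+ (D * q)) lo (ℤ.∣i∣≡0⇒i≡0 ∣z∣≡0)))

    t≢0 : NonZero t
    t≢0 = ∣.quotient≢0 a∣z {{∣z∣≢0}}

    at≡z : ℤ.+ a ℤ.* ℤ.+ t ≡ z
    at≡z = trans (sym (ℤ.pos-* a t)) (trans
      (cong ℤ.+_ (sym (∣.m∣n⇒n≡m*quotient a∣z)))
      (ℤ.0≤i⇒+∣i∣≡i (ℤ.i≤j⇒0≤j-i (ℤ.<⇒≤ lo<Dq))))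

    at+lo≡q : ℤ.+ a ℤ.* ℤ.+ t ℤ.+ lo ≡ ℤ.+ (D * q)
    at+lo≡q = trans (cong (ℤ._+ lo) at≡z) (i-j+j≡i (ℤ.+ (D * q)) lo)

    at+hi≡p : ℤ.+ a ℤ.* ℤ.+ t ℤ.+ hi ≡ ℤ.+ (D * (1 + q))
    at+hi≡p = trans (cong (ℤ._+ hi) (trans at≡z z≡)) (i-j+j≡i (ℤ.+ (D * (1 + q))) hi)

-- Edges and cliques

larger/smaller∈R : ∀ a lo hi m n → value m < value n →
                   Realised (value a) lo hi (value m) (value n) → R a hi a lo (n /⁺ m)
larger/smaller∈R a lo hi m n m<n r =
  (mkℕ⁺ t , fraction≡÷ n m p q nq≡pm at+hi≡p at+lo≡q) ,
  fraction-∈ℚ>0∖1 n m (ℕ.>⇒≢ m<n)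
  where open Realised r

smaller/larger∈R : ∀ a lo hi m n → value m < value n →
                   Realised (value a) lo hi (value m) (value n) → R a lo a hi (m /⁺ n)
smaller/larger∈R a lo hi m n m<n r =
  (mkℕ⁺ t , fraction≡÷ m n q p mp≡qn at+lo≡q at+hi≡p) ,
  fraction-∈ℚ>0∖1 m n (ℕ.<⇒≢ m<n)
  where
  open Realised r
  mp≡qn : value m * p ≡ q * value n
  mp≡qn = trans (ℕ.*-comm (value m) p) (trans (sym nq≡pm) (ℕ.*-comm (value n) q))

chain⇒clique : ∀ {α β k} (Γ : SimpleGraph ℕ⁺) → Chain α β k →
               (∀ m n → Linked α β (value m) (value n) → SimpleGraph.Adj Γ m n) → Clique Γ k
chain⇒clique {k = k} Γ C linked⇒adj = record
  { vertex    = vertex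
  ; injective = chain-injective C ∘ cong value
  ; adjacent  = adjacent
  }
  where
  open Chain C
  open SimpleGraph Γ
  vertex : Fin k → ℕ⁺
  vertex i = mkℕ⁺ (term i) {{term≢0 i}}
  adjacent : ∀ {i j} → i ≢ j → Adj (vertex i) (vertex j)
  adjacent {i} {j} i≢j with Fin.<-cmp i j
  ... | tri< i<j _ _ = linked⇒adj _ _ (linked i<j)
  ... | tri≈ _ i≡j _ = contradiction i≡j i≢j
  ... | tri> _ _ j<i = symmetric (linked⇒adj _ _ (linked j<i))

theorem3p2 : (a : ℕ⁺) (b d : ℤ) → b ≢ d → toℤ a ∣ lcm b d → ω (G a b a d) ≡∞
theorem3p2 a@(mkℕ⁺ a′) b d b≢d a∣lcm k with ℤ.<-cmp b d
... | tri< b<d _ _ = chain⇒clique (G a b a d) (chain′ k) λ { m@(mkℕ⁺ _ {{m≢0}}) n l →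
  inj₁ (smaller/larger∈R a b d m n (linked⇒< l) (realise m≢0 l)) }
  where
  s = coprimeSplitting a′ ∣ b ∣ ∣ d ∣ a∣lcm
  open Realise b<d s
... | tri≈ _ b≡d _ = contradiction b≡d b≢d
-- Now the numerator of the fraction is the larger one, so the inverse ratio lies in `R`; the roles
-- of `b` and `d` are exchanged in the splitting.
... | tri> _ _ d<b = chain⇒clique (G a b a d) (chain′ k) λ { m@(mkℕ⁺ _ {{m≢0}}) n l →
  inj₂ (larger/smaller∈R a d b m n (linked⇒< l) (realise m≢0 l)) }
  where
  s = coprimeSplitting a′ ∣ d ∣ ∣ b ∣ (subst (a′ ∣ₙ_) (ℕ.lcm-comm ∣ b ∣ ∣ d ∣) a∣lcm)
  open Realise d<b s
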